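{- Let $A$ be a finite Abelian group of order $n$, and let $G=\mathrm{Cay}(A,S)$ be a Cayley graph on $A$ of degree $r=|S|$. (a) If $\gcd(n,r)=1$, then every group automorphism of $A$, viewed as a bijection $V(G)=A\to A$, is an $A$-distance antimagic labelling of $G$; in particular $G$ is $A$-distance antimagic. (b) If $\exp(A)$ divides $r$, then every group automorphism $f$ of $A$ is an $A$-distance magic labelling of $G$ with magic constant $\sum_{s\in S} f(s)$; in particular $G$ is $A$-distance magic.
   Context: For an Abelian group $A$ and $S\subseteq A\setminus\{0\}$ with $S=-S$, the Cayley graph $\mathrm{Cay}(A,S)$ has vertex set $A$, with $x,y$ adjacent iff $x-y\in S$. $\exp(A)$ is the least positive integer $m$ with $mx=0$ for all $x\in A$. For a graph $G$ with $n$ vertices and an Abelian group $A$ of order $n$ (written additively), and a bijection $f:V(G)\to A$, the weight of $x$ is $w_f(x)=\sum_{y\in N(x)} f(y)$ computed in $A$ ($N(x)$ the open neighbourhood). $f$ is an $A$-distance antimagic labelling if all weights are pairwise distinct, and an $A$-distance magic labelling if all weights are equal (the common value is the magic constant). $G$ is $A$-distance antimagic (resp. magic) if it admits such a labelling. -}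

module Defs where

open import Algebra.Bundles using (AbelianGroup)
open import Algebra.Definitions.RawMonoid using () renaming (_×_ to multiple)
open import Algebra.Morphism.Structures using (module GroupMorphisms)
import Algebra.Properties.AbelianGroup as AbelianGroupProperties
open import Data.Fin.Base using (Fin)
open import Data.List.Base using (List; filter; foldr; length; map; tabulate)
open import Data.Nat.Base using (ℕ; _≤_; _<_)
open import Data.Product.Base using (∃; ∃-syntax; _×_; _,_; proj₁)
open import Function.Bundles using (Bijection)
open import Level using (Level; _⊔_; suc)
open import Relation.Binary.Bundles using (Setoid)
open import Relation.Binary.Core using (Rel)
open import Relation.Binary.Definitions
  using (Irreflexive; Symmetric; _Respects₂_; _Respects_)
  renaming (Decidable to Decidable₂)
import Relation.Binary.PropositionalEquality.Properties as ≡
import Relation.Binary.Reasoning.Setoid as SetoidReasoning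
open import Relation.Nullary using (¬_)
open import Relation.Unary using (Pred; Decidable; _∈_; _∉_; _≐_)

record FiniteSetoid (c ℓ : Level) : Set (suc (c ⊔ ℓ)) where
  field
    setoid      : Setoid c ℓ
    size        : ℕ
    enumeration : Bijection (≡.setoid (Fin size)) setoid

  open Setoid setoid public

-- Subsets of a finite set are decidable, so that they can be counted
-- and summed over.
record FiniteSubset {c ℓ} (X : FiniteSetoid c ℓ) (p : Level) :
                    Set (c ⊔ ℓ ⊔ suc p) where
  open FiniteSetoid X
  field
    member   : Pred Carrier p
    member?  : Decidable member
    respects : member Respects _≈_

  -- Lists every member exactly once, up to _≈_, because the enumeration
  -- of X is a bijection.
  elements : List Carrier
  elements = filter member? (tabulate (Bijection.to enumeration))

  ∣_∣ : ℕ
  ∣_∣ = length elements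

-- Additive notation; the library's AbelianGroup already provides _-_.
record FiniteAbelianGroup (c ℓ : Level) : Set (suc (c ⊔ ℓ)) where
  field
    abelianGroup : AbelianGroup c ℓ
    order        : ℕ
    enumeration  : Bijection (≡.setoid (Fin order))
                             (AbelianGroup.setoid abelianGroup)

  open AbelianGroup abelianGroup public
    renaming (_∙_ to _+_; ε to 0#; _⁻¹ to -_)

  finiteSetoid : FiniteSetoid c ℓ
  finiteSetoid = record
    { setoid      = setoid
    ; size        = order
    ; enumeration = enumeration
    }

  infixr 8 _·_
  _·_ : ℕ → Carrier → Carrier
  _·_ = multiple rawMonoid

sumOver : ∀ {c₁ ℓ₁ p c₂ ℓ₂} {X : FiniteSetoid c₁ ℓ₁}
          (A : FiniteAbelianGroup c₂ ℓ₂) → FiniteSubset X p →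
          (FiniteSetoid.Carrier X → FiniteAbelianGroup.Carrier A) →
          FiniteAbelianGroup.Carrier A
sumOver A T f = foldr _+_ 0# (map f (FiniteSubset.elements T))
  where open FiniteAbelianGroup A

Annihilates : ∀ {c ℓ} → ℕ → FiniteAbelianGroup c ℓ → Set (c ⊔ ℓ)
Annihilates m A = ∀ x → m · x ≈ 0#
  where open FiniteAbelianGroup A

-- The relation exp(A) = e, which determines e.
IsExponent : ∀ {c ℓ} → FiniteAbelianGroup c ℓ → ℕ → Set (c ⊔ ℓ)
IsExponent A e = 0 < e × Annihilates e A
               × (∀ m → 0 < m → Annihilates m A → e ≤ m)

record Automorphism {c ℓ} (A : FiniteAbelianGroup c ℓ) : Set (c ⊔ ℓ) where
  open FiniteAbelianGroup A
  open GroupMorphisms rawGroup rawGroup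
  field
    to                 : Carrier → Carrier
    isGroupIsomorphism : IsGroupIsomorphism to

  open IsGroupIsomorphism isGroupIsomorphism public

  bijection : Bijection setoid setoid
  bijection = record
    { to        = to
    ; cong      = ⟦⟧-cong
    ; bijective = injective , surjective
    }

record Graph (v ℓ e : Level) : Set (suc (v ⊔ ℓ ⊔ e)) where
  field
    vertices : FiniteSetoid v ℓ

  open FiniteSetoid vertices public
    renaming (Carrier to Vertex; setoid to vertexSetoid)

  field
    Adjacent          : Rel Vertex e
    adjacent?         : Decidable₂ Adjacent
    adjacent-resp     : Adjacent Respects₂ _≈_
    adjacent-sym      : Symmetric Adjacent
    adjacent-irrefl   : Irreflexive _≈_ Adjacent

  N : Vertex → FiniteSubset vertices e
  N x = record
    { member   = Adjacent x
    ; member?  = adjacent? x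
    ; respects = λ y≈z → proj₁ adjacent-resp y≈z
    }

record ConnectionSet {c ℓ} (A : FiniteAbelianGroup c ℓ) (p : Level) :
                     Set (c ⊔ ℓ ⊔ suc p) where
  open FiniteAbelianGroup A
  field
    subset : FiniteSubset finiteSetoid p

  open FiniteSubset subset public

  negated : Pred Carrier (c ⊔ ℓ ⊔ p)
  negated x = ∃[ s ] s ∈ member × x ≈ - s

  field
    zero-free : 0# ∉ member
    symmetric : member ≐ negated

Cay : ∀ {c ℓ p} (A : FiniteAbelianGroup c ℓ) → ConnectionSet A p → Graph c ℓ p
Cay A S = record
  { vertices        = finiteSetoid
  ; Adjacent        = λ x y → (x - y) ∈ member
  ; adjacent?       = λ x y → member? (x - y)
  ; adjacent-resp   = (λ y≈z → respects (//-cong refl y≈z))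
                    , (λ x≈z → respects (//-cong x≈z refl))
  ; adjacent-sym    = adj-sym
  ; adjacent-irrefl = λ {x} {y} x≈y x-y∈S →
      zero-free (respects (trans (//-cong x≈y refl) (inverseʳ y)) x-y∈S)
  }
  where
  open FiniteAbelianGroup A
  open ConnectionSet S
  open AbelianGroupProperties abelianGroup using (⁻¹-involutive; ⁻¹-anti-homo-//)

  //-cong : ∀ {x x′ y y′} → x ≈ x′ → y ≈ y′ → (x - y) ≈ (x′ - y′)
  //-cong x≈x′ y≈y′ = ∙-cong x≈x′ (⁻¹-cong y≈y′)

  adj-sym : ∀ {x y} → (x - y) ∈ member → (y - x) ∈ member
  adj-sym {x} {y} x-y∈S with proj₁ symmetric x-y∈S
  ... | s , s∈S , x-y≈-s = respects s≈y-x s∈S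
    where
    open SetoidReasoning setoid
    s≈y-x : s ≈ (y - x)
    s≈y-x = begin
      s           ≈⟨ ⁻¹-involutive s ⟨
      - (- s)     ≈⟨ ⁻¹-cong x-y≈-s ⟨
      - (x - y)   ≈⟨ ⁻¹-anti-homo-// x y ⟩
      y - x       ∎

module _ {v ℓ₁ e c ℓ₂} (G : Graph v ℓ₁ e) (A : FiniteAbelianGroup c ℓ₂) where

  open Graph G using (Vertex; vertexSetoid; N) renaming (_≈_ to _≈ᵥ_)
  open FiniteAbelianGroup A using (Carrier; _≈_; setoid)

  -- The existence of a labelling forces the order of A to be the number
  -- of vertices of G.
  Labelling : Set (v ⊔ ℓ₁ ⊔ c ⊔ ℓ₂)
  Labelling = Bijection vertexSetoid setoid

  weight : Labelling → Vertex → Carrier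
  weight f x = sumOver A (N x) (Bijection.to f)

  IsDistanceAntimagicLabelling : Labelling → Set (v ⊔ ℓ₁ ⊔ ℓ₂)
  IsDistanceAntimagicLabelling f =
    ∀ x y → ¬ (x ≈ᵥ y) → ¬ (weight f x ≈ weight f y)

  IsDistanceMagicLabelling : Labelling → Set (v ⊔ ℓ₂)
  IsDistanceMagicLabelling f = ∀ x y → weight f x ≈ weight f y

  IsMagicConstant : Labelling → Carrier → Set (v ⊔ ℓ₂)
  IsMagicConstant f μ = ∀ x → weight f x ≈ μ

  DistanceAntimagic : Set (v ⊔ ℓ₁ ⊔ c ⊔ ℓ₂)
  DistanceAntimagic = ∃ IsDistanceAntimagicLabelling

  DistanceMagic : Set (v ⊔ ℓ₁ ⊔ c ⊔ ℓ₂)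
  DistanceMagic = ∃ IsDistanceMagicLabelling

{-# OPTIONS --safe #-}

-- The substitution y = x + s turns the weight of x under an automorphism f
-- into Σ_{s ∈ S} f (x + s) = r · f x + Σ_{s ∈ S} f s, using S = - S. If exp(A)
-- divides r the first term vanishes. If gcd(n, r) = 1, equal weights at x and y
-- make f x - f y killed by both r and n, hence zero by Bézout.

module Submission where

open import Defs
open import Algebra.Bundles using (CommutativeMonoid)
import Algebra.Morphism.Construct.Identity as IdentityMorphism
import Algebra.Properties.AbelianGroup as AbelianGroupProperties
import Algebra.Properties.CommutativeMonoid.Mult as Mult
import Algebra.Properties.CommutativeMonoid.Sum as Sum
import Algebra.Properties.CommutativeSemigroup as CommutativeSemigroupProperties
open import Data.Bool.Base using (if_then_else_)
open import Data.Empty using (⊥-elim)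
open import Data.Fin.Base using (Fin; zero; suc)
open import Data.List.Base using (List; []; _∷_; filter; foldr; length; map; tabulate)
open import Data.Nat.Base using (ℕ; zero; suc) renaming (_+_ to _+ℕ_; _*_ to _*ℕ_)
open import Data.Nat.Coprimality using (coprime-Bézout; gcd≡1⇒coprime)
open import Data.Nat.Divisibility using (_∣_; divides)
open import Data.Nat.GCD using (gcd; module Bézout)
open import Data.Product.Base using (_×_; _,_; proj₂)
open import Function.Base using (_∘_)
open import Function.Bundles using (Bijection; Inverse; Func)
import Function.Construct.Composition as Composition
import Function.Construct.Identity as Identity
import Function.Construct.Symmetry as Symmetry
open import Function.Properties.Bijection using (Bijection⇒Inverse)
open import Relation.Binary.PropositionalEquality using (_≡_)
import Relation.Binary.PropositionalEquality as ≡
import Relation.Binary.Reasoning.Setoid as SetoidReasoning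
open import Relation.Nullary using (Dec; yes; no; does)
open import Relation.Unary using (Pred; Decidable; _∈_)

module _ {c ℓ} (A : FiniteAbelianGroup c ℓ) where
  open FiniteAbelianGroup A
  open AbelianGroupProperties abelianGroup
  open CommutativeSemigroupProperties
         (CommutativeMonoid.commutativeSemigroup commutativeMonoid)
    using (interchange)
  open Sum commutativeMonoid using (sum; sum-cong-≋; sum-permute; ∑-distrib-+; sum-replicate)
  open Mult commutativeMonoid using (×-assocˡ; ×-congʳ; ×-congˡ; ×-distrib-+)
  open SetoidReasoning setoid

  -- Enumerating `Y`, applying `φ` and inverting the enumeration of `X` gives a bijection of index
  -- sets, under which a finite sum is invariant. The round trip through `enumX` cancels only up to
  -- `_≈_`, so `g` has to respect the equivalence.
  ∑-bijection : ∀ {c₁ ℓ₁ c₂ ℓ₂} (X : FiniteSetoid c₁ ℓ₁) (Y : FiniteSetoid c₂ ℓ₂)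
                (φ : Inverse (FiniteSetoid.setoid Y) (FiniteSetoid.setoid X))
                (g : Func (FiniteSetoid.setoid X) setoid) →
                sum (Func.to g ∘ Bijection.to (FiniteSetoid.enumeration X)) ≈
                sum (Func.to g ∘ Inverse.to φ ∘ Bijection.to (FiniteSetoid.enumeration Y))
  ∑-bijection X Y φ g = trans
    (sum-permute (Func.to g ∘ Inverse.to enumX)
      (Composition.inverse enumY (Composition.inverse φ (Symmetry.inverse enumX))))
    (sum-cong-≋ {FiniteSetoid.size Y} (λ _ → Func.cong g (Inverse.strictlyInverseˡ enumX _)))
    where
    enumX = Bijection⇒Inverse (FiniteSetoid.enumeration X)
    enumY = Bijection⇒Inverse (FiniteSetoid.enumeration Y)

  if-cong : ∀ {p q} {P : Set p} {Q : Set q} (P? : Dec P) (Q? : Dec Q) →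
            (P → Q) → (Q → P) → ∀ {a b} → a ≈ b →
            (if does P? then a else 0#) ≈ (if does Q? then b else 0#)
  if-cong (yes _) (yes _) _   _   a≈b = a≈b
  if-cong (yes p) (no ¬q) P⇒Q _   _   = ⊥-elim (¬q (P⇒Q p))
  if-cong (no ¬p) (yes q) _   Q⇒P _   = ⊥-elim (¬p (Q⇒P q))
  if-cong (no _)  (no _)  _   _   _   = refl

  -- Replaces a filtered list, whose length and order depend on the subset, by a sum over the whole
  -- index set with zeros off the subset. Permutations of the index set apply to the latter form.
  foldr-filter-tabulate :
    ∀ {b p} {B : Set b} {P : Pred B p} (P? : Decidable P) (h : B → Carrier)
    {n} (e : Fin n → B) →
    foldr _+_ 0# (map h (filter P? (tabulate e))) ≈
    sum (λ i → if does (P? (e i)) then h (e i) else 0#)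
  foldr-filter-tabulate P? h {zero}  e = refl
  foldr-filter-tabulate P? h {suc n} e with P? (e zero)
  ... | yes _ = ∙-congˡ (foldr-filter-tabulate P? h (e ∘ suc))
  ... | no  _ = trans (foldr-filter-tabulate P? h (e ∘ suc)) (sym (identityˡ _))

  -- Change of variables for sums over subsets: extend the summand by zero, reindex over the whole
  -- set, and use that `φ` matches membership in `U` with membership in `T`.
  sumOver-bijection :
    ∀ {c₁ ℓ₁ p c₂ ℓ₂ q} {X : FiniteSetoid c₁ ℓ₁} {Y : FiniteSetoid c₂ ℓ₂}
    (T : FiniteSubset X p) (U : FiniteSubset Y q)
    (φ : Inverse (FiniteSetoid.setoid Y) (FiniteSetoid.setoid X)) →
    (∀ {y} → Inverse.to φ y ∈ FiniteSubset.member T → y ∈ FiniteSubset.member U) →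
    (∀ {y} → y ∈ FiniteSubset.member U → Inverse.to φ y ∈ FiniteSubset.member T) →
    (h : Func (FiniteSetoid.setoid X) setoid) →
    sumOver A T (Func.to h) ≈ sumOver A U (Func.to h ∘ Inverse.to φ)
  sumOver-bijection {X = X} {Y} T U φ T⇒U U⇒T h = begin
    sumOver A T h.to
      ≈⟨ foldr-filter-tabulate T.member? h.to (Bijection.to X.enumeration) ⟩
    sum (restricted ∘ Bijection.to X.enumeration)
      ≈⟨ ∑-bijection X Y φ (record { to = restricted ; cong = restricted-cong }) ⟩
    sum (restricted ∘ φ.to ∘ Bijection.to Y.enumeration)
      ≈⟨ sum-cong-≋ (λ i → let y = Bijection.to Y.enumeration i in
           if-cong (T.member? (φ.to y)) (U.member? y) T⇒U U⇒T refl) ⟩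
    sum (λ i → let y = Bijection.to Y.enumeration i in
               if does (U.member? y) then h.to (φ.to y) else 0#)
      ≈⟨ foldr-filter-tabulate U.member? (h.to ∘ φ.to) (Bijection.to Y.enumeration) ⟨
    sumOver A U (h.to ∘ φ.to) ∎
    where
    module X = FiniteSetoid X
    module Y = FiniteSetoid Y
    module T = FiniteSubset T
    module U = FiniteSubset U
    module φ = Inverse φ
    module h = Func h

    restricted : X.Carrier → Carrier
    restricted x = if does (T.member? x) then h.to x else 0#

    -- The extension by zero respects equality because membership in `T` does.
    restricted-cong : ∀ {x y} → x X.≈ y → restricted x ≈ restricted y
    restricted-cong x≈y = if-cong (T.member? _) (T.member? _)
      (T.respects x≈y) (T.respects (X.sym x≈y)) (h.cong x≈y)

  -- The constant is collected once per list entry. With `a` the image of a vertex, this is where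
  -- the degree enters the weight formula.
  foldr-map-+ : ∀ {b} {B : Set b} {a : Carrier} {h k : B → Carrier} →
                (∀ x → k x ≈ a + h x) → (xs : List B) →
                foldr _+_ 0# (map k xs) ≈ length xs · a + foldr _+_ 0# (map h xs)
  foldr-map-+ k≈a+h []       = sym (identityˡ 0#)
  foldr-map-+ k≈a+h (x ∷ xs) =
    trans (∙-cong (k≈a+h x) (foldr-map-+ k≈a+h xs)) (interchange _ _ _ _)

  translation : Carrier → Inverse setoid setoid
  translation a = record
    { to        = a +_
    ; from      = (- a) +_
    ; to-cong   = ∙-congˡ
    ; from-cong = ∙-congˡ
    ; inverse   = (λ y≈-a+x → trans (∙-congˡ y≈-a+x) (\\-leftDividesˡ a _))
                , (λ y≈a+x → trans (∙-congˡ y≈a+x) (\\-leftDividesʳ a _))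
    }

  -- Translation by a permutes A, so Σ x = Σ (a + x) = order · a + Σ x.
  order-annihilates : Annihilates order A
  order-annihilates a = identityˡ-unique _ _ (begin
    order · a + sum enum             ≈⟨ ∙-congʳ (sum-replicate order) ⟨
    sum {order} (λ _ → a) + sum enum ≈⟨ ∑-distrib-+ (λ _ → a) enum ⟨
    sum (λ i → a + enum i)
      ≈⟨ ∑-bijection finiteSetoid finiteSetoid (translation a) (Identity.function setoid) ⟨
    sum enum                        ∎)
    where enum = Bijection.to enumeration

  ·-zeroʳ : ∀ m → m · 0# ≈ 0#
  ·-zeroʳ zero    = refl
  ·-zeroʳ (suc m) = trans (identityˡ _) (·-zeroʳ m)

  *-annihilates : ∀ m n {a} → n · a ≈ 0# → (m *ℕ n) · a ≈ 0#
  *-annihilates m n {a} na≈0 = begin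
    (m *ℕ n) · a  ≈⟨ ×-assocˡ a m n ⟨
    m · n · a     ≈⟨ ×-congʳ m na≈0 ⟩
    m · 0#        ≈⟨ ·-zeroʳ m ⟩
    0#            ∎

  -- This is the subtraction-free shape of Bézout over the naturals: two annihilating multiples that
  -- differ by one force `a` to vanish.
  1+n≡m-annihilates : ∀ {m n a} → 1 +ℕ n ≡ m → m · a ≈ 0# → n · a ≈ 0# → a ≈ 0#
  1+n≡m-annihilates {m} {n} {a} 1+n≡m ma≈0 na≈0 = begin
    a           ≈⟨ identityʳ a ⟨
    a + 0#      ≈⟨ ∙-congˡ na≈0 ⟨
    suc n · a   ≈⟨ ×-congˡ 1+n≡m ⟩
    m · a       ≈⟨ ma≈0 ⟩
    0#          ∎

  coprime-annihilates : ∀ m n {a} → gcd m n ≡ 1 → m · a ≈ 0# → n · a ≈ 0# → a ≈ 0#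
  coprime-annihilates m n gcd≡1 ma≈0 na≈0
    with coprime-Bézout (gcd≡1⇒coprime {m} {n} gcd≡1)
  -- Two cases, according to which of the two multiples is the larger by one.
  ... | Bézout.+- x y 1+yn≡xm =
    1+n≡m-annihilates 1+yn≡xm (*-annihilates x m ma≈0) (*-annihilates y n na≈0)
  ... | Bézout.-+ x y 1+xm≡yn =
    1+n≡m-annihilates 1+xm≡yn (*-annihilates y n na≈0) (*-annihilates x m ma≈0)

  ·-injective-coprime : ∀ r {a b} → gcd order r ≡ 1 → r · a ≈ r · b → a ≈ b
  ·-injective-coprime r {a} {b} gcd≡1 ra≈rb = x∙y⁻¹≈ε⇒x≈y a b
    (coprime-annihilates order r gcd≡1 (order-annihilates (a - b))
      -- Adding `r · b` to both sides reduces the vanishing of `r · (a - b)` to distributivity over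
      -- a sum, with no rule for multiples of a negative.
      (∙-cancelʳ (r · b) _ _ (begin
        r · (a - b) + r · b  ≈⟨ ×-distrib-+ (a - b) b r ⟨
        r · ((a - b) + b)    ≈⟨ ×-congʳ r (//-rightDividesˡ b a) ⟩
        r · a                ≈⟨ ra≈rb ⟩
        r · b                ≈⟨ identityˡ _ ⟨
        0# + r · b           ∎)))

  -- Serves as the witness for both existence claims.
  idAutomorphism : Automorphism A
  idAutomorphism = record
    { to = λ x → x
    ; isGroupIsomorphism = IdentityMorphism.isGroupIsomorphism rawGroup refl
    }

  module _ {p} (S : ConnectionSet A p) where
    open ConnectionSet S renaming (∣_∣ to degree)

    private
      G : Graph c ℓ p
      G = Cay A S

    -‿closed : ∀ {s} → s ∈ member → (- s) ∈ member
    -‿closed s∈S = proj₂ symmetric (_ , s∈S , refl)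

    -- Shows that `x` and `x + s` are adjacent exactly when `- s` lies in the connection set.
    x-[x+s]≈-s : ∀ x s → x - (x + s) ≈ - s
    x-[x+s]≈-s x s = begin
      x - (x + s)      ≈⟨ ⁻¹-anti-homo-// (x + s) x ⟨
      - (x + s - x)    ≈⟨ ⁻¹-cong (xyx⁻¹≈y x s) ⟩
      - s              ∎

    weight-automorphism :
      ∀ (f : Automorphism A) x → let open Automorphism f in
      weight G A bijection x ≈ degree · to x + sumOver A subset to
    weight-automorphism f x = trans
      (sumOver-bijection (Graph.N G x) subset (translation x)
        -- Adjacency puts `- s` in the connection set; negating once more gives `s` itself.
        (λ {s} x-[x+s]∈S → respects (⁻¹-involutive s)
          (-‿closed (respects (x-[x+s]≈-s x s) x-[x+s]∈S)))
        (λ {s} s∈S → respects (sym (x-[x+s]≈-s x s)) (-‿closed s∈S))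
        (record { to = to ; cong = ⟦⟧-cong }))
      -- Each summand splits as `to (x + s) ≈ to x + to s`.
      (foldr-map-+ (∙-homo x) elements)
      where open Automorphism f

    automorphism-antimagic :
      gcd order degree ≡ 1 → (f : Automorphism A) →
      IsDistanceAntimagicLabelling G A (Automorphism.bijection f)
    automorphism-antimagic gcd≡1 f x y x≉y wx≈wy =
      -- Both weights contain the same sum over the connection set; cancelling it leaves
      -- `degree · to x ≈ degree · to y`.
      x≉y (injective (·-injective-coprime degree gcd≡1
        (∙-cancelʳ (sumOver A subset to) _ _ (begin
          degree · to x + sumOver A subset to  ≈⟨ weight-automorphism f x ⟨
          weight G A bijection x               ≈⟨ wx≈wy ⟩
          weight G A bijection y               ≈⟨ weight-automorphism f y ⟩
          degree · to y + sumOver A subset to  ∎))))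
      where open Automorphism f

    automorphism-magicConstant :
      Annihilates degree A → (f : Automorphism A) →
      IsMagicConstant G A (Automorphism.bijection f)
        (sumOver A subset (Automorphism.to f))
    automorphism-magicConstant r·a≈0 f x = begin
      weight G A bijection x               ≈⟨ weight-automorphism f x ⟩
      degree · to x + sumOver A subset to  ≈⟨ ∙-congʳ (r·a≈0 (to x)) ⟩
      0# + sumOver A subset to             ≈⟨ identityˡ _ ⟩
      sumOver A subset to                  ∎
      where open Automorphism f

    magicConstant⇒magic : ∀ (f : Labelling G A) {μ} →
                          IsMagicConstant G A f μ → IsDistanceMagicLabelling G A f
    magicConstant⇒magic f w≈μ x y = trans (w≈μ x) (sym (w≈μ y))

mainTheorem2 : ∀ {c ℓ p} (A : FiniteAbelianGroup c ℓ) (S : ConnectionSet A p) →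
    let n = FiniteAbelianGroup.order A
        r = ConnectionSet.∣_∣ S
        G = Cay A S
    in
    (gcd n r ≡ 1 →
      (∀ (f : Automorphism A) →
        IsDistanceAntimagicLabelling G A (Automorphism.bijection f))
      × DistanceAntimagic G A)
    ×
    (∀ (e : ℕ) → IsExponent A e → e ∣ r →
      (∀ (f : Automorphism A) →
        IsDistanceMagicLabelling G A (Automorphism.bijection f)
        × IsMagicConstant G A (Automorphism.bijection f)
            (sumOver A (ConnectionSet.subset S) (Automorphism.to f)))
      × DistanceMagic G A)
mainTheorem2 A S =
  (λ gcd≡1 →
    let antimagic = automorphism-antimagic A S gcd≡1
    in antimagic , (bijection (idAutomorphism A) , antimagic (idAutomorphism A))) ,
  (λ { e (_ , e-annihilates , _) (divides q r≡q*e) →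
    -- Writing r as q times e, multiplication by r is multiplication by e, which kills everything,
    -- followed by multiplication by q.
    let r-annihilates a = ≡.subst (λ m → m · a ≈ 0#)
                            (≡.sym r≡q*e) (*-annihilates A q e (e-annihilates a))
        constant = automorphism-magicConstant A S r-annihilates
        magic f = magicConstant⇒magic A S (bijection f) (constant f)
    in (λ f → magic f , constant f)
     , (bijection (idAutomorphism A) , magic (idAutomorphism A)) })
  where
  open Automorphism using (bijection)
  open FiniteAbelianGroup A using (_·_; _≈_; 0#)
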